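{- Let $m\geq 1$ be an integer. Every graph $G$ in the family $\mathcal{B}_m$ is an ASR-graph with domination number $\gamma(G)=m$.
   Context: $\gamma(G)$ denotes the domination number of a finite simple graph $G$. For an edge $e=uv$ of $G$, $G-e$ is the graph obtained by deleting $e$, and $G_e$ is the graph obtained by subdividing $e$: delete $e$, add a new vertex $w$ and the edges $uw$ and $wv$. A finite connected simple graph $G$ of order at least two is an ASR-graph (anti-sub-removable graph) if $\gamma(G-e)\neq\gamma(G_e)$ for every edge $e$ of $G$. A universal vertex is a vertex adjacent to all other vertices of the graph. For vertex-disjoint graphs $G$ and $H$, the sum $G+H$ is the graph with vertex set $V(G)\cup V(H)$ and edge set $E(G)\cup E(H)\cup\{xy: x\in V(G),\ y\in V(H)\}$. For a graph $H$ and $X\subseteq V(H)$, $H[X]$ is the subgraph induced by $X$, and $N_H[X]$ is the set of vertices of $H$ that are in $X$ or adjacent to a vertex of $X$. For vertex-disjoint graphs $F_1,\dots,F_m$, $E(F_1,\dots,F_m)$ denotes the set of all possible edges between different $F_i$'s, i.e. the edge set of the complete $m$-partite graph with parts $V(F_1),\dots,V(F_m)$. Definition of $\mathcal{B}_m$: a finite connected simple graph $G$ belongs to $\mathcal{B}_m$ if there exist $m$ vertex-disjoint ASR-graphs $G_1,\dots,G_m$, each of order at least three and with domination number one, such that $V(G)=\bigcup_{i=1}^m V(G_i)$ and $E(G)=\bigcup_{i=1}^m E(G_i)\cup\widetilde{E}(G)$, where: - for $1\le i\le m$, $G_i=K_{r_i}+H_i$, where $r_i$ is the number of universal vertices of $G_i$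 (so $K_{r_i}$ is induced by the universal vertices and $H_i$ by the remaining vertices; $H_i$ need not be connected); - for $1\le i\le m$, $S_i$ is a subset of $V(H_i)$ such that $N_{H_i}[S_i]\neq V(H_i)$; - $\widetilde{E}(G)\subseteq E(H_1[S_1],H_2[S_2],\dots,H_m[S_m])$. -}

module Defs where

open import Data.Empty using (⊥)
open import Data.Fin using (Fin; zero; suc)
open import Data.Fin.Properties using (_≟_; any?; all?)
open import Data.Fin.Subset using (Subset; inside; _∈_; _⊆_; _∩_; _∪_; ∣_∣; Empty)
open import Data.Fin.Subset.Properties
  using (_∈?_; _⊆?_; anySubset?; x∈p∩q⁺; x∈p∪q⁺)
open import Data.Nat using (ℕ; zero; suc; _≤_; _≥_; z≤n; s≤s)
import Data.Nat.Properties as ℕ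
open import Data.Product using (∃; ∃-syntax; ∃₂; _×_; _,_; proj₁; proj₂)
open import Data.Sum using (_⊎_; inj₁; inj₂)
open import Data.Vec using (_∷_; tabulate; here; there)
open import Data.Vec.Properties using (lookup∘tabulate; lookup⇒[]=; []=⇒lookup)
open import Function using (_∘_; _⇔_; mk⇔)
open import Function.Bundles using (Equivalence)
open import Level using (0ℓ)
open import Relation.Binary using (Rel; Decidable; Symmetric)
open import Relation.Binary.Construct.Closure.ReflexiveTransitive using (Star)
open import Relation.Binary.PropositionalEquality using (_≡_; _≢_; refl; sym; trans)
open import Relation.Nullary using (Dec; yes; no; does; ¬_; contradiction)
open import Relation.Nullary.Decidable using (_×-dec_; _⊎-dec_; _→-dec_; ¬?; dec-true)
import Relation.Unary as U

private
  variable
    n : ℕ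

comprehension : {P : U.Pred (Fin n) 0ℓ} → U.Decidable P → Subset n
comprehension P? = tabulate (does ∘ P?)

∈-comprehension : {P : U.Pred (Fin n) 0ℓ} (P? : U.Decidable P) →
                  ∀ {x} → x ∈ comprehension P? ⇔ P x
∈-comprehension P? {x} = mk⇔ to from
  where
  to : x ∈ comprehension P? → _
  to x∈ with P? x | trans (sym (lookup∘tabulate (does ∘ P?) x)) ([]=⇒lookup x∈)
  ... | yes p | _ = p
  from : _ → x ∈ comprehension P?
  from p = lookup⇒[]= x _ (trans (lookup∘tabulate (does ∘ P?) x) (dec-true (P? x) p))

-- A finite simple graph whose vertex set is a subset of Fin n.  Several
-- graphs over the same n can thus be disjoint, be subgraphs of each other,
-- and be united, without renaming vertices.
record Graph (n : ℕ) : Set₁ where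
  field
    V        : Subset n
    E        : Rel (Fin n) 0ℓ
    E?       : Decidable E
    E-sym    : Symmetric E
    E-irrefl : ∀ {x} → ¬ E x x
    E⇒∈V     : ∀ {x y} → E x y → x ∈ V

open Graph public

order : Graph n → ℕ
order G = ∣ V G ∣

Connected : Graph n → Set
Connected G = ∀ {x y} → x ∈ V G → y ∈ V G → Star (E G) x y

Disjoint : Graph n → Graph n → Set
Disjoint G H = Empty (V G ∩ V H)

infix 4 _≈_
_≈_ : Graph n → Graph n → Set
G ≈ H = V G ≡ V H × (∀ x y → E G x y ⇔ E H x y)

infix 8 _[_]
_[_] : Graph n → Subset n → Graph n
G [ X ] = record
  { V        = V G ∩ X
  ; E        = λ x y → E G x y × x ∈ X × y ∈ X
  ; E?       = λ x y → E? G x y ×-dec x ∈? X ×-dec y ∈? X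
  ; E-sym    = λ (e , x∈ , y∈) → E-sym G e , y∈ , x∈
  ; E-irrefl = E-irrefl G ∘ proj₁
  ; E⇒∈V     = λ (e , x∈ , _) → x∈p∩q⁺ (E⇒∈V G e , x∈)
  }

sum : (G H : Graph n) → Disjoint G H → Graph n
sum {n} G H disjoint = record
  { V        = V G ∪ V H
  ; E        = λ x y → (E G x y ⊎ E H x y) ⊎ (Join x y ⊎ Join y x)
  ; E?       = λ x y → (E? G x y ⊎-dec E? H x y) ⊎-dec (join? x y ⊎-dec join? y x)
  ; E-sym    = λ where
      (inj₁ (inj₁ e)) → inj₁ (inj₁ (E-sym G e))
      (inj₁ (inj₂ e)) → inj₁ (inj₂ (E-sym H e))
      (inj₂ (inj₁ j)) → inj₂ (inj₂ j)
      (inj₂ (inj₂ j)) → inj₂ (inj₁ j)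
  ; E-irrefl = λ where
      (inj₁ (inj₁ e)) → E-irrefl G e
      (inj₁ (inj₂ e)) → E-irrefl H e
      (inj₂ (inj₁ j)) → disjoint (_ , x∈p∩q⁺ j)
      (inj₂ (inj₂ j)) → disjoint (_ , x∈p∩q⁺ j)
  ; E⇒∈V     = λ where
      (inj₁ (inj₁ e))        → x∈p∪q⁺ (inj₁ (E⇒∈V G e))
      (inj₁ (inj₂ e))        → x∈p∪q⁺ (inj₂ (E⇒∈V H e))
      (inj₂ (inj₁ (x∈ , _))) → x∈p∪q⁺ (inj₁ x∈)
      (inj₂ (inj₂ (_ , x∈))) → x∈p∪q⁺ (inj₂ x∈)
  }
  where
  Join : Rel (Fin n) 0ℓ
  Join x y = x ∈ V G × y ∈ V H
  join? : Decidable Join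
  join? x y = x ∈? V G ×-dec y ∈? V H

SameEdge : (u v x y : Fin n) → Set
SameEdge u v x y = (x ≡ u × y ≡ v) ⊎ (x ≡ v × y ≡ u)

sameEdge? : (u v x y : Fin n) → Dec (SameEdge u v x y)
sameEdge? u v x y = (x ≟ u ×-dec y ≟ v) ⊎-dec (x ≟ v ×-dec y ≟ u)

swapEdge : ∀ {u v x y : Fin n} → SameEdge u v x y → SameEdge u v y x
swapEdge (inj₁ (p , q)) = inj₂ (q , p)
swapEdge (inj₂ (p , q)) = inj₁ (q , p)

deleteEdge : (G : Graph n) {u v : Fin n} → E G u v → Graph n
deleteEdge G {u} {v} _ = record
  { V        = V G
  ; E        = λ x y → E G x y × ¬ SameEdge u v x y
  ; E?       = λ x y → E? G x y ×-dec ¬? (sameEdge? u v x y)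
  ; E-sym    = λ (e , ≢uv) → E-sym G e , ≢uv ∘ swapEdge
  ; E-irrefl = E-irrefl G ∘ proj₁
  ; E⇒∈V     = E⇒∈V G ∘ proj₁
  }

-- The new vertex is zero; an old vertex x becomes suc x.
subdivideEdge : (G : Graph n) {u v : Fin n} → E G u v → Graph (suc n)
subdivideEdge {n} G {u} {v} uv = record
  { V        = inside ∷ V G
  ; E        = Adj
  ; E?       = adj?
  ; E-sym    = λ {x} {y} → adj-sym x y
  ; E-irrefl = λ {x} → adj-irrefl x
  ; E⇒∈V     = λ {x} {y} → adj⇒∈ x y
  }
  where
  G-e = deleteEdge G uv

  Adj : Rel (Fin (suc n)) 0ℓ
  Adj zero    zero    = ⊥
  Adj zero    (suc y) = y ≡ u ⊎ y ≡ v
  Adj (suc x) zero    = x ≡ u ⊎ x ≡ v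
  Adj (suc x) (suc y) = E G-e x y

  adj? : Decidable Adj
  adj? zero    zero    = no λ ()
  adj? zero    (suc y) = y ≟ u ⊎-dec y ≟ v
  adj? (suc x) zero    = x ≟ u ⊎-dec x ≟ v
  adj? (suc x) (suc y) = E? G-e x y

  adj-sym : ∀ x y → Adj x y → Adj y x
  adj-sym zero    (suc y) a = a
  adj-sym (suc x) zero    a = a
  adj-sym (suc x) (suc y) a = E-sym G-e a

  adj-irrefl : ∀ x → ¬ Adj x x
  adj-irrefl (suc x) a = E-irrefl G-e a

  adj⇒∈ : ∀ x y → Adj x y → x ∈ inside ∷ V G
  adj⇒∈ zero    _       _           = here
  adj⇒∈ (suc x) zero    (inj₁ refl) = there (E⇒∈V G uv)
  adj⇒∈ (suc x) zero    (inj₂ refl) = there (E⇒∈V G (E-sym G uv))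
  adj⇒∈ (suc x) (suc y) a           = there (E⇒∈V G-e a)

Reached : Graph n → Subset n → Fin n → Set
Reached G X x = x ∈ V G × (x ∈ X ⊎ ∃[ y ] (y ∈ X × E G x y))

reached? : (G : Graph n) (X : Subset n) → U.Decidable (Reached G X)
reached? G X x = x ∈? V G ×-dec (x ∈? X ⊎-dec any? λ y → y ∈? X ×-dec E? G x y)

closedNeighbourhood : Graph n → Subset n → Subset n
closedNeighbourhood G X = comprehension (reached? G X)

Dominating : Graph n → Subset n → Set
Dominating G D = D ⊆ V G × V G ⊆ closedNeighbourhood G D

HasDominatingSetOfSize : Graph n → ℕ → Set
HasDominatingSetOfSize G k = ∃[ D ] (Dominating G D × ∣ D ∣ ≡ k)

hasDominatingSetOfSize? : (G : Graph n) → U.Decidable (HasDominatingSetOfSize G)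
hasDominatingSetOfSize? G k = anySubset? λ D →
  (D ⊆? V G ×-dec V G ⊆? closedNeighbourhood G D) ×-dec ∣ D ∣ ℕ.≟ k

Least : U.Pred ℕ 0ℓ → U.Pred ℕ 0ℓ
Least P k = P k × (∀ j → P j → k ≤ j)

least : {P : U.Pred ℕ 0ℓ} → U.Decidable P → ∀ k → P k → ∃ (Least P)
least P? k pk with P? 0
... | yes p0 = 0 , p0 , λ _ _ → z≤n
least P? zero    p0 | no ¬p0 = contradiction p0 ¬p0
least {P} P? (suc k) pk | no ¬p0 with least {P ∘ suc} (P? ∘ suc) k pk
... | l , pl , l≤ = suc l , pl , λ where
  zero    p0 → contradiction p0 ¬p0
  (suc j) pj → s≤s (l≤ j pj)

dominationNumber : (G : Graph n) → ∃ (Least (HasDominatingSetOfSize G))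
dominationNumber G = least (hasDominatingSetOfSize? G) (order G)
  (V G , ((λ x∈ → x∈) , λ x∈ → Equivalence.from (∈-comprehension (reached? G (V G))) (x∈ , inj₁ x∈)) , refl)

γ : Graph n → ℕ
γ = proj₁ ∘ dominationNumber

record ASR (G : Graph n) : Set where
  field
    connected : Connected G
    order≥2   : order G ≥ 2
    γ-e≢γₑ    : ∀ {u v} (e : E G u v) → γ (deleteEdge G e) ≢ γ (subdivideEdge G e)

Universal : Graph n → Fin n → Set
Universal G x = x ∈ V G × (∀ y → y ∈ V G → y ≢ x → E G x y)

universal? : (G : Graph n) → U.Decidable (Universal G)
universal? G x = x ∈? V G ×-dec all? λ y → y ∈? V G →-dec ¬? (y ≟ x) →-dec E? G x y

universalVertices : Graph n → Subset n
universalVertices G = comprehension (universal? G)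

IsComplete : ℕ → Graph n → Set
IsComplete r K = order K ≡ r × (∀ {x y} → x ∈ V K → y ∈ V K → x ≢ y → E K x y)

multipartiteEdges : ∀ {m} → (Fin m → Graph n) → Rel (Fin n) 0ℓ
multipartiteEdges F x y = ∃₂ λ i j → i ≢ j × x ∈ V (F i) × y ∈ V (F j)

record 𝓑 (m : ℕ) (G : Graph n) : Set₁ where
  field
    connected : Connected G

    Gᵢ        : Fin m → Graph n
    disjoint  : ∀ i j → i ≢ j → Disjoint (Gᵢ i) (Gᵢ j)
    asr       : ∀ i → ASR (Gᵢ i)
    order≥3   : ∀ i → order (Gᵢ i) ≥ 3
    γ≡1       : ∀ i → γ (Gᵢ i) ≡ 1

  r : Fin m → ℕ
  r i = ∣ universalVertices (Gᵢ i) ∣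

  -- As K i has exactly r i vertices, all of them universal in the sum, the
  -- sum decomposition forces V (K i) to be the set of universal vertices
  -- of Gᵢ i and V (H i) to be the set of the remaining ones.
  field
    K H       : Fin m → Graph n
    K-Kᵣ      : ∀ i → IsComplete (r i) (K i)
    K∩H≡∅     : ∀ i → Disjoint (K i) (H i)
    Gᵢ≈K+H    : ∀ i → Gᵢ i ≈ sum (K i) (H i) (K∩H≡∅ i)

    S         : Fin m → Subset n
    S⊆H       : ∀ i → S i ⊆ V (H i)
    N[S]≢H    : ∀ i → closedNeighbourhood (H i) (S i) ≢ V (H i)

    Ẽ         : Rel (Fin n) 0ℓ
    Ẽ-sym     : Symmetric Ẽ
    Ẽ⊆        : ∀ {x y} → Ẽ x y → multipartiteEdges (λ i → H i [ S i ]) x y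

    V≡⋃       : ∀ x → x ∈ V G ⇔ (∃[ i ] x ∈ V (Gᵢ i))
    E≡⋃∪Ẽ     : ∀ x y → E G x y ⇔ ((∃[ i ] E (Gᵢ i) x y) ⊎ Ẽ x y)

{-# OPTIONS --safe #-}

-- Choose xⱼ in V(Hⱼ) but not in the closed neighbourhood of Sⱼ in Hⱼ.  Then the
-- closed neighbourhood of xⱼ in G lies in V(Gⱼ) ∖ Sⱼ, so a dominating set of G
-- meets every V(Gⱼ) outside Sⱼ; in particular γ(G) ≥ m.
-- In G_e, let w be the new vertex and let d dominate w.
--   * If e is an edge of Gᵢ, this still gives one element for each j ≠ i, and d
--     serves for i.  If d = w, a universal vertex of Gᵢ off e needs a dominator
--     in V(Gᵢ) as well.  If d is an end of e, the other end needs a dominator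
--     besides d: it lies in V(Gᵢ) ∪ {w} or in some Sⱼ with j ≠ i.
--   * If e is an edge of Ẽ, this still gives one element for each j, and d is a
--     further one, being w or an element of some Sⱼ.
-- Hence γ(G_e) > m.  On the other hand an ASR-graph with domination number one
-- and order at least three has, for every edge e, a universal vertex off e; such
-- vertices, one in each Gⱼ, dominate G - e, so γ(G - e) ≤ m.
module Submission where

open import Defs
open import Data.Fin using (Fin; zero; suc)
open import Data.Fin.Properties using (_≟_; any?; suc-injective)
open import Data.Fin.Subset using (Subset; inside; outside; _∈_; _∉_; _⊆_; _-_; ∣_∣)
open import Data.Fin.Subset.Properties
open import Data.Empty using (⊥)
open import Data.Nat using (ℕ; zero; suc; _≤_; _<_; _≥_; z≤n; s≤s)
open import Data.Nat.Properties
  using (≤-trans; ≤-antisym; ≤-reflexive; <⇒≱; ≮⇒≥; _<?_; m≤n⇒m≤1+n)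
open import Data.Product using (∃; ∃-syntax; _×_; _,_; proj₁; proj₂; map₂)
open import Data.Sum using (_⊎_; inj₁; inj₂)
open import Data.Vec using ([]; _∷_; lookup; here; there)
open import Function using (_∘_)
open import Function.Bundles using (Equivalence)
open import Level using (0ℓ)
open import Relation.Binary.PropositionalEquality
  using (_≡_; _≢_; refl; sym; trans; cong; subst; ≢-sym)
open import Relation.Nullary using (¬_; yes; no; contradiction)
open import Relation.Nullary.Decidable using (_×-dec_; ¬?; decidable-stable)
import Relation.Unary as U

open Equivalence using (to; from)

private
  variable
    m n : ℕ

-- Cardinalities of finite sets

∣p∣≤1+∣p-x∣ : (p : Subset n) (x : Fin n) → ∣ p ∣ ≤ suc ∣ p - x ∣
∣p∣≤1+∣p-x∣ (inside  ∷ p) zero    = s≤s (≤-reflexive (cong ∣_∣ (sym (p─⊥≡p p))))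
∣p∣≤1+∣p-x∣ (outside ∷ p) zero    = m≤n⇒m≤1+n (≤-reflexive (cong ∣_∣ (sym (p─⊥≡p p))))
∣p∣≤1+∣p-x∣ (inside  ∷ p) (suc x) = s≤s (∣p∣≤1+∣p-x∣ p x)
∣p∣≤1+∣p-x∣ (outside ∷ p) (suc x) = ∣p∣≤1+∣p-x∣ p x

x∉p-x : (p : Subset n) (x : Fin n) → x ∉ p - x
x∉p-x (inside  ∷ p) zero    ()
x∉p-x (outside ∷ p) zero    ()
x∉p-x (s       ∷ p) (suc x) (there x∈) = x∉p-x p x x∈

covered⇒∣p∣≤ : (p : Subset n) (f : Fin m → Fin n) →
               (∀ {x} → x ∈ p → ∃[ i ] x ≡ f i) → ∣ p ∣ ≤ m
covered⇒∣p∣≤ {n} {zero} p f cover =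
  ≤-reflexive (trans (cong ∣_∣ (Empty-unique empty)) (∣⊥∣≡0 n))
  where
  empty : ¬ (∃ λ x → x ∈ p)
  empty (x , x∈) with cover x∈
  ... | () , _
covered⇒∣p∣≤ {n} {suc m} p f cover =
  ≤-trans (∣p∣≤1+∣p-x∣ p (f zero)) (s≤s (covered⇒∣p∣≤ (p - f zero) (f ∘ suc) cover′))
  where
  cover′ : ∀ {x} → x ∈ p - f zero → ∃[ i ] x ≡ f (suc i)
  cover′ x∈ with cover (p─q⊆p p _ x∈)
  ... | zero  , refl = contradiction x∈ (x∉p-x p (f zero))
  ... | suc i , eq   = i , eq

injective⇒≤∣p∣ : (p : Subset n) (f : Fin m → Fin n) →
                 (∀ {i j} → f i ≡ f j → i ≡ j) → (∀ i → f i ∈ p) → m ≤ ∣ p ∣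
injective⇒≤∣p∣ {m = zero}  p f inj f∈ = z≤n
injective⇒≤∣p∣ {m = suc m} p f inj f∈ =
  ≤-trans (s≤s (injective⇒≤∣p∣ (p - f zero) (f ∘ suc) (suc-injective ∘ inj) f∈′))
          (x∈p⇒∣p-x∣<∣p∣ (f∈ zero))
  where
  f∈′ : ∀ i → f (suc i) ∈ p - f zero
  f∈′ i = x∈p∧x≢y⇒x∈p-y (f∈ (suc i)) λ eq → contradiction (inj eq) λ ()

distinct⇒2≤∣p∣ : {p : Subset n} {x y : Fin n} → x ∈ p → y ∈ p → x ≢ y → 2 ≤ ∣ p ∣
distinct⇒2≤∣p∣ {p = p} {x} {y} x∈ y∈ x≢y = injective⇒≤∣p∣ p f inj f∈
  where
  f : Fin 2 → Fin _
  f = lookup (x ∷ y ∷ [])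
  inj : ∀ {i j} → f i ≡ f j → i ≡ j
  inj {zero}     {zero}     _  = refl
  inj {zero}     {suc zero} eq = contradiction eq x≢y
  inj {suc zero} {zero}     eq = contradiction (sym eq) x≢y
  inj {suc zero} {suc zero} _  = refl
  f∈ : ∀ i → f i ∈ p
  f∈ zero       = x∈
  f∈ (suc zero) = y∈

⊆∧∣∣≥⇒⊇ : {p q : Subset n} → p ⊆ q → ∣ q ∣ ≤ ∣ p ∣ → q ⊆ p
⊆∧∣∣≥⇒⊇ {p = p} p⊆q ∣q∣≤∣p∣ {x} x∈q = decidable-stable (x ∈? p) λ x∉p →
  <⇒≱ (p⊂q⇒∣p∣<∣q∣ (p⊆q , x , x∈q , x∉p)) ∣q∣≤∣p∣

-- The classes `Near j` are disjoint, so the picked elements are distinct. The extra `z` differs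
-- from the pick of its own class because it violates `Q j`, and from all others by its class; hence
-- `p - z` still contains `m` elements.
transversal⇒<∣p∣ : (p : Subset n) (Near Q : Fin m → U.Pred (Fin n) 0ℓ) →
                   (∀ {i j} x → Near i x → Near j x → i ≡ j) →
                   (∀ j → ∃[ x ] (x ∈ p × Near j x × Q j x)) →
                   ∃[ j ] ∃[ z ] (z ∈ p × Near j z × ¬ Q j z) →
                   m < ∣ p ∣
transversal⇒<∣p∣ {n} {m} p Near Q unique pick (j , z , z∈ , near , ¬Q) =
  ≤-trans (s≤s (injective⇒≤∣p∣ (p - z) f inj f∈)) (x∈p⇒∣p-x∣<∣p∣ z∈)
  where
  f : Fin m → Fin n
  f i = proj₁ (pick i)
  inj : ∀ {i k} → f i ≡ f k → i ≡ k
  inj {i} {k} eq with pick i | pick k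
  inj refl | x , _ , nearᵢ , _ | _ , _ , nearₖ , _ = unique x nearᵢ nearₖ
  f∈ : ∀ i → f i ∈ p - z
  f∈ i with pick i
  ... | x , x∈ , nearᵢ , q = x∈p∧x≢y⇒x∈p-y x∈ λ where
    refl → ¬Q (subst (λ k → Q k z) (unique z nearᵢ near) q)

-- Domination

∃dominator : (G : Graph n) {D : Subset n} → Dominating G D → ∀ {x} → x ∈ V G →
             ∃[ y ] (y ∈ D × (y ≡ x ⊎ E G x y))
∃dominator G {D} (_ , V⊆) {x} x∈ with to (∈-comprehension (reached? G D)) (V⊆ x∈)
... | _ , inj₁ x∈D             = x , x∈D , inj₁ refl
... | _ , inj₂ (y , y∈D , xy)  = y , y∈D , inj₂ xy

≤γ : (G : Graph n) {k : ℕ} → (∀ D → Dominating G D → k ≤ ∣ D ∣) → k ≤ γ G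
≤γ G k≤ with dominationNumber G
... | _ , (D , dom , refl) , _ = k≤ D dom

γ≤ : (G : Graph n) (f : Fin m → Fin n) → (∀ i → f i ∈ V G) →
     (∀ {x} → x ∈ V G → ∃[ i ] (x ≡ f i ⊎ E G x (f i))) → γ G ≤ m
γ≤ {n} {m} G f f∈ cover = ≤-trans
  (proj₂ (proj₂ (dominationNumber G)) ∣ D ∣ (D , (D⊆V , V⊆N[D]) , refl))
  (covered⇒∣p∣≤ D f (to (∈-comprehension image?)))
  where
  -- `f` may repeat values, so its image has at most `m` elements, which is enough for an upper
  -- bound.
  image? : U.Decidable (λ x → ∃[ i ] x ≡ f i)
  image? x = any? λ i → x ≟ f i
  D : Subset n
  D = comprehension image?
  D⊆V : D ⊆ V G
  D⊆V x∈ with to (∈-comprehension image?) x∈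
  ... | i , refl = f∈ i
  V⊆N[D] : V G ⊆ closedNeighbourhood G D
  V⊆N[D] x∈ = from (∈-comprehension (reached? G D)) (x∈ , reach (cover x∈))
    where
    reach : ∀ {x} → ∃[ i ] (x ≡ f i ⊎ E G x (f i)) → x ∈ D ⊎ ∃[ y ] (y ∈ D × E G x y)
    reach (i , inj₁ eq) = inj₁ (from (∈-comprehension image?) (i , eq))
    reach (i , inj₂ e)  = inj₂ (f i , from (∈-comprehension image?) (i , refl) , e)

-- The vertex `x` forces a minimum dominating set to be nonempty; having fewer than two elements, it
-- is a single vertex, which must dominate everything.
γ<2⇒∃universal : (G : Graph n) {x : Fin n} → x ∈ V G → γ G < 2 → ∃ (Universal G)
γ<2⇒∃universal G x∈ γ<2 with dominationNumber G
... | _ , (D , dom , refl) , _ with ∃dominator G dom x∈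
... | d , d∈D , _ = d , proj₁ dom d∈D , adjacent
  where
  adjacent : ∀ y → y ∈ V G → y ≢ d → E G d y
  adjacent y y∈ y≢d with ∃dominator G dom y∈
  ... | z , z∈D , z~y with d ≟ z | z~y
  ... | no d≢z   | _         = contradiction (distinct⇒2≤∣p∣ d∈D z∈D d≢z) (<⇒≱ γ<2)
  ... | yes refl | inj₁ refl = contradiction refl y≢d
  ... | yes refl | inj₂ yd   = E-sym G yd

-- ASR-graphs with domination number one

module _ (G : Graph n) where

  E⇒∈Vʳ : ∀ {x y} → E G x y → y ∈ V G
  E⇒∈Vʳ xy = E⇒∈V G (E-sym G xy)

  module _ {u v : Fin n} (uv : E G u v) where

    u≢v : u ≢ v
    u≢v refl = E-irrefl G uv

    universal-deleteEdge : ∀ {k} → Universal (deleteEdge G uv) k →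
                           Universal G k × k ≢ u × k ≢ v
    universal-deleteEdge (k∈ , adj) = (k∈ , λ y y∈ y≢k → proj₁ (adj y y∈ y≢k)) , k≢u , k≢v
      where
      k≢u : _ ≢ u
      k≢u refl = proj₂ (adj v (E⇒∈Vʳ uv) (≢-sym u≢v)) (inj₁ (refl , refl))
      k≢v : _ ≢ v
      k≢v refl = proj₂ (adj u (E⇒∈V G uv) u≢v) (inj₂ (refl , refl))

    -- The new vertex has only two neighbours. An old vertex adjacent to it is an end of the edge,
    -- and has lost the other end as a neighbour.
    ¬universal-subdivideEdge : order G ≥ 3 → ∀ {k} → ¬ Universal (subdivideEdge G uv) k
    ¬universal-subdivideEdge order≥3 {zero} (_ , adj) =
      <⇒≱ order≥3 (covered⇒∣p∣≤ (V G) (lookup (u ∷ v ∷ [])) λ {x} → cover x)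
      where
      cover : ∀ x → x ∈ V G → ∃[ i ] x ≡ lookup (u ∷ v ∷ []) i
      cover x x∈ with adj (suc x) (there x∈) (λ ())
      ... | inj₁ x≡u = zero , x≡u
      ... | inj₂ x≡v = suc zero , x≡v
    ¬universal-subdivideEdge _ {suc k} (_ , adj) with adj zero here (λ ())
    ... | inj₁ refl = proj₂ (adj (suc v) (there (E⇒∈Vʳ uv)) λ where refl → u≢v refl)
                            (inj₁ (refl , refl))
    ... | inj₂ refl = proj₂ (adj (suc u) (there (E⇒∈V G uv)) λ where refl → u≢v refl)
                            (inj₂ (refl , refl))

    module _ {k : Fin n} (universal : Universal G k) (k∈e : k ≡ u ⊎ k ≡ v) where

      ends : Fin 2 → Fin n
      ends = lookup (u ∷ v ∷ [])

      ends∈V : ∀ i → ends i ∈ V G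
      ends∈V zero       = E⇒∈V G uv
      ends∈V (suc zero) = E⇒∈Vʳ uv

      -- One end is universal in `G`, and its edges to vertices other than the two ends survive the
      -- deletion. The same holds after subdivision.
      ends-cover : ∀ {x} → x ∈ V G → ∃[ i ] (x ≡ ends i ⊎ E (deleteEdge G uv) x (ends i))
      ends-cover {x} x∈ with x ≟ u | x ≟ v
      ... | yes x≡u | _       = zero , inj₁ x≡u
      ... | no _    | yes x≡v = suc zero , inj₁ x≡v
      ... | no x≢u  | no x≢v  = by-universal k∈e
        where
        off : ∀ {y} → ¬ SameEdge u v x y
        off (inj₁ (x≡u , _)) = x≢u x≡u
        off (inj₂ (x≡v , _)) = x≢v x≡v
        by-universal : k ≡ u ⊎ k ≡ v → ∃[ i ] (x ≡ ends i ⊎ E (deleteEdge G uv) x (ends i))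
        by-universal (inj₁ refl) = zero , inj₂ (E-sym G (proj₂ universal x x∈ x≢u) , off)
        by-universal (inj₂ refl) = suc zero , inj₂ (E-sym G (proj₂ universal x x∈ x≢v) , off)

      γ-deleteEdge≤2 : γ (deleteEdge G uv) ≤ 2
      γ-deleteEdge≤2 = γ≤ (deleteEdge G uv) ends ends∈V ends-cover

      γ-subdivideEdge≤2 : γ (subdivideEdge G uv) ≤ 2
      γ-subdivideEdge≤2 = γ≤ (subdivideEdge G uv) (suc ∘ ends) (there ∘ ends∈V) λ {x} → cover x
        where
        cover : ∀ x → x ∈ inside ∷ V G →
                ∃[ i ] (x ≡ suc (ends i) ⊎ E (subdivideEdge G uv) x (suc (ends i)))
        cover zero    _          = zero , inj₂ (inj₁ refl)
        cover (suc x) (there x∈) with ends-cover x∈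
        ... | i , inj₁ eq = i , inj₁ (cong suc eq)
        ... | i , inj₂ e  = i , inj₂ e

    -- If no single vertex dominates `G` minus the edge, then deletion and subdivision both give
    -- domination number 2, against the ASR property. A single dominating vertex is universal in `G`
    -- and cannot be an end of the deleted edge.
    γ-e≢γₑ⇒∃universal-off-edge :
      ∀ {k} → Universal G k → k ≡ u ⊎ k ≡ v → ASR G → order G ≥ 3 →
      ∃[ k ] (Universal G k × k ≢ u × k ≢ v)
    γ-e≢γₑ⇒∃universal-off-edge universal k∈e asr order≥3 with γ (deleteEdge G uv) <? 2
    ... | yes γ<2 = map₂ universal-deleteEdge (γ<2⇒∃universal (deleteEdge G uv) (E⇒∈V G uv) γ<2)
    ... | no γ≮2  = contradiction
      (trans (≤-antisym (γ-deleteEdge≤2 universal k∈e) (≮⇒≥ γ≮2))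
             (≤-antisym 2≤γₑ (γ-subdivideEdge≤2 universal k∈e)))
      (ASR.γ-e≢γₑ asr uv)
      where
      2≤γₑ : 2 ≤ γ (subdivideEdge G uv)
      2≤γₑ = ≮⇒≥ λ γ<2 → ¬universal-subdivideEdge order≥3
        (proj₂ (γ<2⇒∃universal (subdivideEdge G uv) here γ<2))

    ∃universal-off-edge : ASR G → order G ≥ 3 → γ G ≡ 1 →
                          ∃[ k ] (Universal G k × k ≢ u × k ≢ v)
    ∃universal-off-edge asr order≥3 γ≡1
      with γ<2⇒∃universal G (E⇒∈V G uv) (s≤s (≤-reflexive γ≡1))
    ... | k , universal with k ≟ u | k ≟ v
    ... | no k≢u  | no k≢v  = k , universal , k≢u , k≢v
    ... | yes k≡u | _       = γ-e≢γₑ⇒∃universal-off-edge universal (inj₁ k≡u) asr order≥3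
    ... | no _    | yes k≡v = γ-e≢γₑ⇒∃universal-off-edge universal (inj₂ k≡v) asr order≥3

-- The family 𝓑

module _ {G : Graph n} (b : 𝓑 m G) where
  open 𝓑 b hiding (connected)

  V⊆G : ∀ {i x} → x ∈ V (Gᵢ i) → x ∈ V G
  V⊆G x∈ = from (V≡⋃ _) (_ , x∈)

  part-unique : ∀ {i j x} → x ∈ V (Gᵢ i) → x ∈ V (Gᵢ j) → i ≡ j
  part-unique {i} {j} x∈i x∈j = decidable-stable (i ≟ j) λ i≢j →
    disjoint i j i≢j (_ , x∈p∩q⁺ (x∈i , x∈j))

  K⊆G : ∀ {i x} → x ∈ V (K i) → x ∈ V (Gᵢ i)
  K⊆G {i} x∈ = subst (_ ∈_) (sym (proj₁ (Gᵢ≈K+H i))) (x∈p∪q⁺ (inj₁ x∈))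

  H⊆G : ∀ {i x} → x ∈ V (H i) → x ∈ V (Gᵢ i)
  H⊆G {i} x∈ = subst (_ ∈_) (sym (proj₁ (Gᵢ≈K+H i))) (x∈p∪q⁺ (inj₂ x∈))

  S⊆G : ∀ {i x} → x ∈ S i → x ∈ V (Gᵢ i)
  S⊆G x∈ = H⊆G (S⊆H _ x∈)

  E-in-H : ∀ {i x y} → E (Gᵢ i) x y → x ∈ V (H i) → y ∈ V (H i) → E (H i) x y
  E-in-H {i} {x} {y} xy x∈ y∈ with to (proj₂ (Gᵢ≈K+H i) x y) xy
  ... | inj₁ (inj₁ e)        = contradiction (x , x∈p∩q⁺ (E⇒∈V (K i) e , x∈)) (K∩H≡∅ i)
  ... | inj₁ (inj₂ e)        = e
  ... | inj₂ (inj₁ (x∈K , _)) = contradiction (x , x∈p∩q⁺ (x∈K , x∈)) (K∩H≡∅ i)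
  ... | inj₂ (inj₂ (y∈K , _)) = contradiction (y , x∈p∩q⁺ (y∈K , y∈)) (K∩H≡∅ i)

  K⇒universal : ∀ {i x} → x ∈ V (K i) → Universal (Gᵢ i) x
  K⇒universal {i} {x} x∈ = K⊆G x∈ , adjacent
    where
    adjacent : ∀ y → y ∈ V (Gᵢ i) → y ≢ x → E (Gᵢ i) x y
    adjacent y y∈ y≢x
      with x∈p∪q⁻ (V (K i)) (V (H i)) (subst (y ∈_) (proj₁ (Gᵢ≈K+H i)) y∈)
    ... | inj₁ y∈K = from (proj₂ (Gᵢ≈K+H i) x y)
                       (inj₁ (inj₁ (proj₂ (K-Kᵣ i) x∈ y∈K (≢-sym y≢x))))
    ... | inj₂ y∈H = from (proj₂ (Gᵢ≈K+H i) x y) (inj₂ (inj₁ (x∈ , y∈H)))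

  universal⇒∉S : ∀ {i x} → Universal (Gᵢ i) x → x ∉ S i
  universal⇒∉S {i} {x} universal x∈S = K∩H≡∅ i (x , x∈p∩q⁺ (x∈K , S⊆H i x∈S))
    where
    x∈K : x ∈ V (K i)
    -- `V (K i)` is contained in the set of universal vertices and has the same size, so the two
    -- sets coincide.
    x∈K = ⊆∧∣∣≥⇒⊇ (λ y∈ → from (∈-comprehension (universal? (Gᵢ i))) (K⇒universal y∈))
                  (≤-reflexive (sym (proj₁ (K-Kᵣ i))))
                  (from (∈-comprehension (universal? (Gᵢ i))) universal)

  Ẽ⇒∈S : ∀ {x y} → Ẽ x y → ∃[ i ] x ∈ S i
  Ẽ⇒∈S xy with Ẽ⊆ xy
  ... | i , _ , _ , x∈ , _ = i , proj₂ (x∈p∩q⁻ (V (H i)) (S i) x∈)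

  -- Every end of an `Ẽ` edge lies in some `S j`, and by disjointness of the parts only `S i` could
  -- contain `x`.
  E-stays : ∀ {i x y} → x ∈ V (Gᵢ i) → x ∉ S i → E G x y → E (Gᵢ i) x y
  E-stays {i} {x} {y} x∈ x∉S xy with to (E≡⋃∪Ẽ x y) xy
  ... | inj₁ (j , e) = subst (λ k → E (Gᵢ k) x y) (part-unique (E⇒∈V (Gᵢ j) e) x∈) e
  ... | inj₂ e with Ẽ⇒∈S e
  ... | j , x∈S = contradiction (subst (λ k → x ∈ S k) (part-unique (S⊆G x∈S) x∈) x∈S) x∉S

  ∃far : ∀ i → ∃[ x ] (x ∈ V (H i) × ¬ Reached (H i) (S i) x)
  ∃far i with any? (λ x → x ∈? V (H i) ×-dec ¬? (reached? (H i) (S i) x))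
  ... | yes far = far
  ... | no ¬far = contradiction (⊆-antisym N⊆V V⊆N) (N[S]≢H i)
    where
    N⊆V : closedNeighbourhood (H i) (S i) ⊆ V (H i)
    N⊆V x∈ = proj₁ (to (∈-comprehension (reached? (H i) (S i))) x∈)
    V⊆N : V (H i) ⊆ closedNeighbourhood (H i) (S i)
    V⊆N {x} x∈ = from (∈-comprehension (reached? (H i) (S i)))
      (decidable-stable (reached? (H i) (S i) x) λ ¬reached → ¬far (x , x∈ , ¬reached))

  far∉S : ∀ {i x} → x ∈ V (H i) → ¬ Reached (H i) (S i) x → x ∉ S i
  far∉S x∈ ¬reached x∈S = ¬reached (x∈ , inj₁ x∈S)

  -- A far vertex is outside `S i`, so its edges stay in `Gᵢ i`. A neighbour in `S i` would be a
  -- neighbour in `H i`, putting `x` in the closed neighbourhood of `S i`.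
  far-neighbour : ∀ {i x y} → x ∈ V (H i) → ¬ Reached (H i) (S i) x → y ≡ x ⊎ E G x y →
                  y ∈ V (Gᵢ i) × y ∉ S i
  far-neighbour x∈ ¬reached (inj₁ refl) = H⊆G x∈ , far∉S x∈ ¬reached
  far-neighbour {i} x∈ ¬reached (inj₂ xy) =
    E⇒∈Vʳ (Gᵢ i) e , λ y∈S → ¬reached (x∈ , inj₂ (_ , y∈S , E-in-H e x∈ (S⊆H i y∈S)))
    where e = E-stays (H⊆G x∈) (far∉S x∈ ¬reached) xy

  ∃universal : ∀ i → ∃ (Universal (Gᵢ i))
  ∃universal i = γ<2⇒∃universal (Gᵢ i) (H⊆G (proj₁ (proj₂ (∃far i)))) (s≤s (≤-reflexive (γ≡1 i)))

  -- The domination number of `G`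

  m≤γ : m ≤ γ G
  m≤γ = ≤γ G λ D dom →
    let pick : ∀ i → ∃[ y ] (y ∈ D × y ∈ V (Gᵢ i))
        pick i = let x , x∈ , ¬reached = ∃far i
                     y , y∈D , y~x = ∃dominator G dom (V⊆G (H⊆G x∈))
                 in  y , y∈D , proj₁ (far-neighbour x∈ ¬reached y~x)
    in  injective⇒≤∣p∣ D (proj₁ ∘ pick)
          (λ {i} {j} eq → part-unique (proj₂ (proj₂ (pick i)))
                            (subst (_∈ V (Gᵢ j)) (sym eq) (proj₂ (proj₂ (pick j)))))
          (proj₁ ∘ proj₂ ∘ pick)

  γ≤m : γ G ≤ m
  γ≤m = γ≤ G k (λ i → V⊆G (proj₁ (proj₂ (∃universal i)))) cover
    where
    k : Fin m → Fin n
    k i = proj₁ (∃universal i)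
    cover : ∀ {x} → x ∈ V G → ∃[ i ] (x ≡ k i ⊎ E G x (k i))
    cover {x} x∈ with to (V≡⋃ x) x∈
    ... | i , x∈i with x ≟ k i
    ... | yes eq = i , inj₁ eq
    ... | no x≢k = i , inj₂ (from (E≡⋃∪Ẽ _ _)
                      (inj₁ (i , E-sym (Gᵢ i) (proj₂ (proj₂ (∃universal i)) x x∈i x≢k))))

  -- Deletion and subdivision of an edge of `G`

  module _ {u v : Fin n} (uv : E G u v) where

    -- The ends of an `Ẽ` edge lie in sets `S i`, which contain no universal vertices. An edge of
    -- another part misses `Gᵢ j` altogether, and for an edge of `Gᵢ j` itself the ASR property is
    -- used.
    universal-off-edge : ∀ j → ∃[ k ] (Universal (Gᵢ j) k × k ≢ u × k ≢ v)
    universal-off-edge j with to (E≡⋃∪Ẽ u v) uv | ∃universal j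
    ... | inj₂ e | k , universal = k , universal , k≢ (Ẽ⇒∈S e) , k≢ (Ẽ⇒∈S (Ẽ-sym e))
      where
      k≢ : ∀ {x} → ∃[ i ] x ∈ S i → k ≢ x
      k≢ (i , x∈S) refl = universal⇒∉S
        (subst (λ l → Universal (Gᵢ l) k) (part-unique (proj₁ universal) (S⊆G x∈S)) universal) x∈S
    ... | inj₁ (i , e) | k , universal with i ≟ j
    ... | yes refl = ∃universal-off-edge (Gᵢ i) e (asr i) (order≥3 i) (γ≡1 i)
    ... | no i≢j   = k , universal , k≢ (E⇒∈V (Gᵢ i) e) , k≢ (E⇒∈Vʳ (Gᵢ i) e)
      where
      k≢ : ∀ {x} → x ∈ V (Gᵢ i) → k ≢ x
      k≢ x∈ refl = i≢j (part-unique x∈ (proj₁ universal))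

    γ-deleteEdge≤m : γ (deleteEdge G uv) ≤ m
    γ-deleteEdge≤m = γ≤ (deleteEdge G uv) k (λ i → V⊆G (proj₁ (universal i))) cover
      where
      k : Fin m → Fin n
      k i = proj₁ (universal-off-edge i)
      universal : ∀ i → Universal (Gᵢ i) (k i)
      universal i = proj₁ (proj₂ (universal-off-edge i))
      off : ∀ i {x} → ¬ SameEdge u v x (k i)
      off i (inj₁ (_ , k≡v)) = proj₂ (proj₂ (proj₂ (universal-off-edge i))) k≡v
      off i (inj₂ (_ , k≡u)) = proj₁ (proj₂ (proj₂ (universal-off-edge i))) k≡u
      cover : ∀ {x} → x ∈ V G → ∃[ i ] (x ≡ k i ⊎ E (deleteEdge G uv) x (k i))
      cover {x} x∈ with to (V≡⋃ x) x∈
      ... | i , x∈i with x ≟ k i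
      ... | yes eq = i , inj₁ eq
      ... | no x≢k = i , inj₂
        (from (E≡⋃∪Ẽ _ _) (inj₁ (i , E-sym (Gᵢ i) (proj₂ (universal i) x x∈i x≢k))) , off i)

    Gₑ : Graph (suc n)
    Gₑ = subdivideEdge G uv

    -- The new vertex must belong to some part for the count in transversal⇒<∣p∣;
    -- it is assigned to part i.
    Near : Fin m → Fin m → U.Pred (Fin (suc n)) 0ℓ
    Near i j zero    = j ≡ i
    Near i j (suc x) = x ∈ V (Gᵢ j)

    near-unique : ∀ i {j k} x → Near i j x → Near i k x → j ≡ k
    near-unique i zero    refl refl = refl
    near-unique i (suc x) x∈j  x∈k  = part-unique x∈j x∈k

    -- The new vertex is never private, so in the `Ẽ` case it can serve as the extra element.
    Private : Fin m → U.Pred (Fin (suc n)) 0ℓ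
    Private j zero    = ⊥
    Private j (suc x) = x ∉ S j

    module _ {D : Subset (suc n)} (dom : Dominating Gₑ D) where

      dominator-off-edge : ∀ {x} → x ∈ V G → x ≢ u → x ≢ v →
                           ∃[ y ] (suc y ∈ D × (y ≡ x ⊎ E G x y))
      dominator-off-edge x∈ x≢u x≢v with ∃dominator Gₑ dom (there x∈)
      ... | zero  , _   , inj₂ (inj₁ x≡u) = contradiction x≡u x≢u
      ... | zero  , _   , inj₂ (inj₂ x≡v) = contradiction x≡v x≢v
      ... | suc y , y∈D , inj₁ refl       = y , y∈D , inj₁ refl
      ... | suc y , y∈D , inj₂ (xy , _)   = y , y∈D , inj₂ xy

      private-dominator : ∀ i j →
                          (∀ {x} → x ∈ V (H j) → ¬ Reached (H j) (S j) x → x ≢ u × x ≢ v) →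
                          ∃[ y ] (y ∈ D × Near i j y × Private j y)
      private-dominator i j far≢ =
        let x , x∈ , ¬reached = ∃far j
            x≢u , x≢v = far≢ x∈ ¬reached
            y , y∈D , y~x = dominator-off-edge (V⊆G (H⊆G x∈)) x≢u x≢v
        in  suc y , y∈D , far-neighbour x∈ ¬reached y~x

      dominator-of-new : ∃[ d ] (d ∈ D × (d ≡ zero ⊎ d ≡ suc u ⊎ d ≡ suc v))
      dominator-of-new with ∃dominator Gₑ dom here
      ... | zero  , d∈D , _                = zero , d∈D , inj₁ refl
      ... | suc d , d∈D , inj₂ (inj₁ refl) = suc d , d∈D , inj₂ (inj₁ refl)
      ... | suc d , d∈D , inj₂ (inj₂ refl) = suc d , d∈D , inj₂ (inj₂ refl)

      m<∣D∣-Ẽ : Ẽ u v → m < ∣ D ∣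
      m<∣D∣-Ẽ e with Ẽ⇒∈S e | Ẽ⇒∈S (Ẽ-sym e)
      ... | i , u∈S | i′ , v∈S = transversal⇒<∣p∣ D (Near i) Private (near-unique i)
        -- Both ends of the edge lie in sets `S k`, whereas far vertices do not; so every far vertex
        -- is off the edge.
        (λ j → private-dominator i j λ x∈ ¬reached →
          far≢ u∈S x∈ ¬reached , far≢ v∈S x∈ ¬reached)
        (extra dominator-of-new)
        where
        far≢ : ∀ {j k x y} → y ∈ S k → x ∈ V (H j) → ¬ Reached (H j) (S j) x → x ≢ y
        far≢ {j} {x = x} y∈S x∈ ¬reached refl = far∉S x∈ ¬reached
          (subst (λ l → x ∈ S l) (part-unique (S⊆G y∈S) (H⊆G x∈)) y∈S)
        extra : ∃[ d ] (d ∈ D × (d ≡ zero ⊎ d ≡ suc u ⊎ d ≡ suc v)) →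
                ∃[ j ] ∃[ z ] (z ∈ D × Near i j z × ¬ Private j z)
        extra (_ , d∈D , inj₁ refl)        = i , zero , d∈D , refl , λ ()
        extra (_ , d∈D , inj₂ (inj₁ refl)) = i , suc u , d∈D , S⊆G u∈S , λ u∉S → u∉S u∈S
        extra (_ , d∈D , inj₂ (inj₂ refl)) = i′ , suc v , d∈D , S⊆G v∈S , λ v∉S → v∉S v∈S

      m<∣D∣-Gᵢ : ∀ i → E (Gᵢ i) u v → m < ∣ D ∣
      m<∣D∣-Gᵢ i e with dominator-of-new
      ... | d , d∈D , d~w = transversal⇒<∣p∣ D (Near i) Q (near-unique i) pick (extra d~w)
        where
        u∈ : u ∈ V (Gᵢ i)
        u∈ = E⇒∈V (Gᵢ i) e
        v∈ : v ∈ V (Gᵢ i)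
        v∈ = E⇒∈Vʳ (Gᵢ i) e

        -- Part `i` is represented by `d` itself, every other part by a private dominator. An extra
        -- element is thus one of part `i` other than `d`, or one of `S j` with `j` different from
        -- `i`.
        Q : Fin m → U.Pred (Fin (suc n)) 0ℓ
        Q j x = (j ≡ i → x ≡ d) × (j ≢ i → Private j x)

        near-d : d ≡ zero ⊎ d ≡ suc u ⊎ d ≡ suc v → Near i i d
        near-d (inj₁ refl)        = refl
        near-d (inj₂ (inj₁ refl)) = u∈
        near-d (inj₂ (inj₂ refl)) = v∈

        pick : ∀ j → ∃[ x ] (x ∈ D × Near i j x × Q j x)
        pick j with j ≟ i
        ... | yes refl = d , d∈D , near-d d~w , (λ _ → refl) , λ i≢i → contradiction refl i≢i
        ... | no j≢i =
          let y , y∈D , near , private-y = private-dominator i j λ x∈ _ →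
                (λ where refl → j≢i (part-unique (H⊆G x∈) u∈)) ,
                (λ where refl → j≢i (part-unique (H⊆G x∈) v∈))
          in  y , y∈D , near , (λ j≡i → contradiction j≡i j≢i) , λ _ → private-y

        Extra : Set
        Extra = ∃[ j ] ∃[ z ] (z ∈ D × Near i j z × ¬ Q j z)

        extra-neighbour : ∀ {x y} → x ∈ V (Gᵢ i) → E G x y → suc y ∈ D → suc y ≢ d → Extra
        extra-neighbour {x} {y} x∈ xy y∈D y≢d with to (E≡⋃∪Ẽ x y) xy
        ... | inj₁ (j , e′) = i , suc y , y∈D ,
          subst (λ l → y ∈ V (Gᵢ l)) (part-unique (E⇒∈V (Gᵢ j) e′) x∈) (E⇒∈Vʳ (Gᵢ j) e′) ,
          λ q → y≢d (proj₁ q refl)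
        ... | inj₂ e′ with Ẽ⇒∈S (Ẽ-sym e′)
        ... | j , y∈S = j , suc y , y∈D , S⊆G y∈S , ¬q
          where
          ¬q : ¬ Q j (suc y)
          ¬q q with j ≟ i
          ... | yes j≡i = y≢d (proj₁ q j≡i)
          ... | no j≢i  = proj₂ q j≢i y∈S

        -- Used for the end `x` of the edge other than `d`: its dominator is not `d`, so it is the
        -- new vertex, `x` itself, or another neighbour.
        extra-end : ∀ {x} → x ∈ V (Gᵢ i) → suc x ≢ d → zero ≢ d →
                    (∀ {y} → E Gₑ (suc x) (suc y) → suc y ≢ d) → Extra
        extra-end {x} x∈ x≢d 0≢d far-d with ∃dominator Gₑ dom (there (V⊆G x∈))
        ... | zero  , z∈D , _         = i , zero , z∈D , refl , λ q → 0≢d (proj₁ q refl)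
        ... | suc y , y∈D , inj₁ refl = i , suc y , y∈D , x∈ , λ q → x≢d (proj₁ q refl)
        ... | suc y , y∈D , inj₂ xy   = extra-neighbour x∈ (proj₁ xy) y∈D (far-d xy)

        extra : d ≡ zero ⊎ d ≡ suc u ⊎ d ≡ suc v → Extra
        -- The new vertex dominates no old vertex but the two ends, so a universal vertex off the
        -- edge needs an old dominator.
        extra (inj₁ refl) with universal-off-edge i
        ... | k , universal , k≢u , k≢v
          with dominator-off-edge (V⊆G (proj₁ universal)) k≢u k≢v
        ... | y , y∈D , inj₁ refl = i , suc y , y∈D , proj₁ universal ,
          λ q → contradiction (proj₁ q refl) λ ()
        ... | y , y∈D , inj₂ ky   = extra-neighbour (proj₁ universal) ky y∈D λ ()
        -- The two ends are not adjacent in `Gₑ`, so neither dominates the other.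
        extra (inj₂ (inj₁ refl)) = extra-end v∈ (λ where refl → u≢v G uv refl) (λ ())
          λ where vu refl → proj₂ vu (inj₂ (refl , refl))
        extra (inj₂ (inj₂ refl)) = extra-end u∈ (λ where refl → u≢v G uv refl) (λ ())
          λ where uv′ refl → proj₂ uv′ (inj₁ (refl , refl))

    m<γ-subdivideEdge : m < γ (subdivideEdge G uv)
    m<γ-subdivideEdge = ≤γ Gₑ λ D dom → bound dom (to (E≡⋃∪Ẽ u v) uv)
      where
      bound : ∀ {D} → Dominating Gₑ D → (∃[ i ] E (Gᵢ i) u v) ⊎ Ẽ u v → m < ∣ D ∣
      bound dom (inj₁ (i , e)) = m<∣D∣-Gᵢ dom i e
      bound dom (inj₂ e)       = m<∣D∣-Ẽ dom e

proposition20 : (m : ℕ) → m ≥ 1 → ∀ {n : ℕ} (G : Graph n) → 𝓑 m G → ASR G × γ G ≡ m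
proposition20 (suc m) m≥1 G b = record
  { connected = 𝓑.connected b
  -- Since there is at least one part, `G` inherits its order bound from the first.
  ; order≥2   = ≤-trans (ASR.order≥2 (𝓑.asr b zero)) (p⊆q⇒∣p∣≤∣q∣ (V⊆G b))
  ; γ-e≢γₑ    = λ e eq → <⇒≱ (m<γ-subdivideEdge b e)
                          (≤-trans (≤-reflexive (sym eq)) (γ-deleteEdge≤m b e))
  } , ≤-antisym (γ≤m b) (m≤γ b)
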